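{- Let $p>q>2$ be prime numbers, and let $\phi$ denote Euler's totient function. Then: (i) $D(\Gamma(\mathbb{Z}_{pq}),x)=\left[(1+x)^{\phi(p)}-1\right]\left[(1+x)^{\phi(q)}-1\right]+x^{\phi(p)}+x^{\phi(q)}$; (ii) $D_t(\Gamma(\mathbb{Z}_{pq}),x)=\left[(1+x)^{\phi(p)}-1\right]\left[(1+x)^{\phi(q)}-1\right]$.
   Context: For a positive integer $n$, the zero-divisor graph $\Gamma(\mathbb{Z}_n)$ is the simple undirected loopless graph whose vertices are the nonzero zero-divisors of the ring $\mathbb{Z}_n$ of integers modulo $n$, two distinct vertices $u,v$ being adjacent if and only if $uv=0$ in $\mathbb{Z}_n$. For a finite simple graph $G$ with vertex set $V$, a set $S\subseteq V$ is a dominating set if every vertex of $V\setminus S$ is adjacent to at least one vertex of $S$; it is a total dominating set if every vertex of $V$ is adjacent to at least one vertex of $S$. Let $d(G,i)$ (resp. $d_t(G,i)$) be the number of dominating sets (resp. total dominating sets) of $G$ of cardinality $i$. The domination polynomial is $D(G,x)=\sum_{i=0}^{|V|}d(G,i)x^i$ and the total domination polynomial is $D_t(G,x)=\sum_{i=0}^{|V|}d_t(G,i)x^i$. -}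

module Defs where

open import Data.Fin.Base using (Fin; toℕ)
open import Data.Fin.Properties as Fin using (all?; any?)
open import Data.Fin.Subset using (Subset; inside; outside; _∈_; _∉_; _⊆_; ∣_∣)
open import Data.Fin.Subset.Properties using (_∈?_; _⊆?_)
open import Data.Integer.Base as ℤ using (ℤ; +_; 0ℤ; 1ℤ)
open import Data.List.Base as List using (List; []; _∷_; _++_; length; filter; upTo)
open import Data.Nat.Base as ℕ using (ℕ; zero; suc; NonZero)
open import Data.Nat.Coprimality using (coprime?)
open import Data.Nat.DivMod using (_mod_)
import Data.Nat.Properties as ℕ
open import Data.Nat.Primality using (Prime; prime⇒nonZero)
open import Data.Product.Base using (∃; _×_; _,_)
open import Data.Vec.Base using ([]; _∷_; tabulate)
open import Function.Base using (_∘_)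
open import Level using (0ℓ)
open import Relation.Binary.Core using (Rel)
import Relation.Binary.Definitions as Binary
open import Relation.Binary.PropositionalEquality using (_≡_; _≢_; refl; sym; trans; cong)
open import Relation.Nullary.Decidable using (Dec; does; ¬?; _×-dec_; _→-dec_)
open import Relation.Nullary.Negation using (¬_)

-- Integer coefficient lists, constant term first.  Trailing zeros are allowed, so
-- equality of polynomials is _≈ₚ_ rather than _≡_.

Poly : Set
Poly = List ℤ

coeff : Poly → ℕ → ℤ
coeff []      _       = 0ℤ
coeff (a ∷ _) zero    = a
coeff (_ ∷ f) (suc i) = coeff f i

infix  4 _≈ₚ_
infixl 6 _+ₚ_ _-ₚ_
infixl 7 _*ₚ_
infixr 8 _^ₚ_

_≈ₚ_ : Rel Poly 0ℓ
f ≈ₚ g = ∀ i → coeff f i ≡ coeff g i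

_+ₚ_ : Poly → Poly → Poly
[]      +ₚ g       = g
(a ∷ f) +ₚ []      = a ∷ f
(a ∷ f) +ₚ (b ∷ g) = (a ℤ.+ b) ∷ (f +ₚ g)

negₚ : Poly → Poly
negₚ = List.map λ a → ℤ.- a

_-ₚ_ : Poly → Poly → Poly
f -ₚ g = f +ₚ negₚ g

-- (a + x f) g = a g + x (f g)
_*ₚ_ : Poly → Poly → Poly
[]      *ₚ g = []
(a ∷ f) *ₚ g = List.map (a ℤ.*_) g +ₚ (0ℤ ∷ (f *ₚ g))

1ₚ : Poly
1ₚ = 1ℤ ∷ []

X : Poly
X = 0ℤ ∷ 1ℤ ∷ []

_^ₚ_ : Poly → ℕ → Poly
f ^ₚ zero  = 1ₚ
f ^ₚ suc k = f *ₚ (f ^ₚ k)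

-- The vertex set is a subset V of an ambient finite set Fin size; adjacency
-- between ambient points outside V is never consulted.

record Graph : Set₁ where
  infix 4 _~_ _~?_
  field
    size     : ℕ
    V        : Subset size
    _~_      : Rel (Fin size) 0ℓ
    _~?_     : Binary.Decidable _~_
    ~-sym    : Binary.Symmetric _~_
    ~-irrefl : ∀ {u} → ¬ (u ~ u)

module _ (G : Graph) where
  open Graph G

  Dominating : Subset size → Set
  Dominating S = S ⊆ V ×
    (∀ v → v ∈ V → v ∉ S → ∃ λ u → u ∈ S × v ~ u)

  TotalDominating : Subset size → Set
  TotalDominating S = S ⊆ V ×
    (∀ v → v ∈ V → ∃ λ u → u ∈ S × v ~ u)

  dominating? : ∀ S → Dec (Dominating S)
  dominating? S = (S ⊆? V) ×-dec
    all? λ v → (v ∈? V) →-dec (¬? (v ∈? S) →-dec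
      any? λ u → (u ∈? S) ×-dec (v ~? u))

  totalDominating? : ∀ S → Dec (TotalDominating S)
  totalDominating? S = (S ⊆? V) ×-dec
    all? λ v → (v ∈? V) →-dec any? λ u → (u ∈? S) ×-dec (v ~? u)

subsets : ∀ n → List (Subset n)
subsets zero    = [] ∷ []
subsets (suc n) = List.map (outside ∷_) (subsets n) ++ List.map (inside ∷_) (subsets n)

d : Graph → ℕ → ℕ
d G i = length (filter (λ S → dominating? G S ×-dec (∣ S ∣ ℕ.≟ i)) (subsets (Graph.size G)))

dₜ : Graph → ℕ → ℕ
dₜ G i = length (filter (λ S → totalDominating? G S ×-dec (∣ S ∣ ℕ.≟ i)) (subsets (Graph.size G)))

D : Graph → Poly
D G = List.map (λ i → + d G i) (upTo (suc ∣ Graph.V G ∣))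

Dₜ : Graph → Poly
Dₜ G = List.map (λ i → + dₜ G i) (upTo (suc ∣ Graph.V G ∣))

module _ {n : ℕ} .{{_ : NonZero n}} where

  infixl 7 _*ₙ_

  0ₙ : Fin n
  0ₙ = 0 mod n

  _*ₙ_ : Fin n → Fin n → Fin n
  u *ₙ v = (toℕ u ℕ.* toℕ v) mod n

  *ₙ-comm : ∀ u v → u *ₙ v ≡ v *ₙ u
  *ₙ-comm u v = cong (_mod n) (ℕ.*-comm (toℕ u) (toℕ v))

  ZeroDivisor : Fin n → Set
  ZeroDivisor u = ∃ λ v → v ≢ 0ₙ × u *ₙ v ≡ 0ₙ

  zeroDivisor? : ∀ u → Dec (ZeroDivisor u)
  zeroDivisor? u = any? λ v → ¬? (v Fin.≟ 0ₙ) ×-dec (u *ₙ v Fin.≟ 0ₙ)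

Γ : (n : ℕ) .{{_ : NonZero n}} → Graph
Γ n = record
  { size     = n
  ; V        = tabulate λ u → does (¬? (u Fin.≟ 0ₙ) ×-dec zeroDivisor? u)
  ; _~_      = λ u v → u ≢ v × u *ₙ v ≡ 0ₙ
  ; _~?_     = λ u v → ¬? (u Fin.≟ v) ×-dec (u *ₙ v Fin.≟ 0ₙ)
  ; ~-sym    = λ {u} {v} (u≢v , uv≡0) → u≢v ∘ sym , trans (*ₙ-comm v u) uv≡0
  ; ~-irrefl = λ (u≢u , _) → u≢u refl
  }

φ : ℕ → ℕ
φ n = length (filter (λ k → coprime? k n) (List.map suc (upTo n)))

prime*prime≢0 : ∀ {p q} → Prime p → Prime q → NonZero (p ℕ.* q)
prime*prime≢0 {p} {q} p-prime q-prime =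
  ℕ.m*n≢0 p q {{prime⇒nonZero p-prime}} {{prime⇒nonZero q-prime}}

{-# OPTIONS --safe #-}
module Submission where

-- The vertices of Γ(ℤ/pq) are the nonzero multiples of q (a set A of φ(p) elements) and
-- the nonzero multiples of p (a set B of φ(q) elements), and Γ(ℤ/pq) is complete bipartite
-- with parts A and B.  There S is totally dominating iff S ⊆ V, S ⊈ A and S ⊈ B, and
-- dominating iff it is totally dominating or equal to A or to B.  In terms of indicators,
--   [S totally dominating] = [S ⊆ V] − [S ⊆ A] − [S ⊆ B] + [S ⊆ ∅],
--   [S dominating]         = [S totally dominating] + [S = A] + [S = B].
-- Since Σ_S [S ⊆ W] x^∣S∣ = (1 + x)^∣W∣, summing over S gives
-- (1+x)^(a+b) − (1+x)^a − (1+x)^b + 1 = ((1+x)^a − 1) ((1+x)^b − 1), where a = φ(p), b = φ(q).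

open import Defs
open import Data.Bool.Base using (Bool; true; false; if_then_else_)
import Data.Bool.Properties as Bool
open import Data.Fin.Base using (Fin; toℕ; fromℕ<)
open import Data.Fin.Properties as Fin using (any?; toℕ-fromℕ<; toℕ-injective; toℕ<n)
open import Data.Fin.Subset using (Subset; inside; outside; _∈_; _∉_; _⊆_; ∣_∣; _∪_; Nonempty) renaming (⊥ to ∅)
open import Data.Fin.Subset.Properties
open import Data.Integer.Base as ℤ using (ℤ; +_; 0ℤ; 1ℤ)
import Data.Integer.Properties as ℤ
open import Data.Integer.Tactic.RingSolver using (solve-∀)
open import Data.List.Base as List using ([]; _∷_; _++_; length; filter; upTo; applyUpTo)
open import Data.List.Properties using (filter-++; length-++; map-upTo)
open import Data.Nat.Base as ℕ using (ℕ; zero; suc; _<_; z≤n; s≤s; NonZero; nonTrivial⇒n>1)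
open import Data.Nat.Coprimality as Coprime using (Coprime; coprime?; coprime-divisor; prime⇒coprime)
open import Data.Nat.Divisibility
open import Data.Nat.DivMod using (m*n%n≡0)
open import Data.Nat.Primality
import Data.Nat.Properties as ℕ
open import Data.Product.Base using (_×_; _,_; proj₁; proj₂; ∃)
open import Data.Sum.Base using (_⊎_; inj₁; inj₂; [_,_]′)
open import Data.Vec.Base using ([]; _∷_; here; there; tabulate)
import Data.Vec.Properties as Vec
open import Function.Base using (_∘_; _$_)
open import Function.Bundles using (_⇔_; mk⇔; Equivalence)
open import Level using (0ℓ)
open import Relation.Binary.PropositionalEquality
open import Relation.Nullary.Decidable
open import Relation.Nullary.Negation using (¬_; contradiction)
open import Relation.Unary using (Pred; Decidable)

private variable
  n : ℕ
  P Q R : Set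

-- Coefficients of sums, products and powers

coeff-+ₚ : ∀ f g i → coeff (f +ₚ g) i ≡ coeff f i ℤ.+ coeff g i
coeff-+ₚ []      g       i       = sym (ℤ.+-identityˡ _)
coeff-+ₚ (a ∷ f) []      i       = sym (ℤ.+-identityʳ _)
coeff-+ₚ (a ∷ f) (b ∷ g) zero    = refl
coeff-+ₚ (a ∷ f) (b ∷ g) (suc i) = coeff-+ₚ f g i

coeff-negₚ : ∀ f i → coeff (negₚ f) i ≡ ℤ.- coeff f i
coeff-negₚ []      i       = refl
coeff-negₚ (a ∷ f) zero    = refl
coeff-negₚ (a ∷ f) (suc i) = coeff-negₚ f i

coeff--ₚ : ∀ f g i → coeff (f -ₚ g) i ≡ coeff f i ℤ.- coeff g i
coeff--ₚ f g i = trans (coeff-+ₚ f (negₚ g) i) (cong (λ z → coeff f i ℤ.+ z) (coeff-negₚ g i))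

coeff-scale : ∀ a f i → coeff (List.map (a ℤ.*_) f) i ≡ a ℤ.* coeff f i
coeff-scale a []      i       = sym (ℤ.*-zeroʳ a)
coeff-scale a (b ∷ f) zero    = refl
coeff-scale a (b ∷ f) (suc i) = coeff-scale a f i

-- The Cauchy product, unrolled along the left factor as `_*ₚ_` is. On coefficient functions the
-- algebra is pointwise, so trailing zeros do not matter.
conv : (ℕ → ℤ) → (ℕ → ℤ) → ℕ → ℤ
conv a b zero    = a 0 ℤ.* b 0
conv a b (suc i) = a 0 ℤ.* b (suc i) ℤ.+ conv (a ∘ suc) b i

conv-zeroˡ : ∀ b i → conv (λ _ → 0ℤ) b i ≡ 0ℤ
conv-zeroˡ b zero    = refl
conv-zeroˡ b (suc i) = trans (ℤ.+-identityˡ _) (conv-zeroˡ b i)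

conv-cong : ∀ {a a′ b b′} → a ≗ a′ → b ≗ b′ → conv a b ≗ conv a′ b′
conv-cong a≗ b≗ zero    = cong₂ ℤ._*_ (a≗ 0) (b≗ 0)
conv-cong a≗ b≗ (suc i) =
  cong₂ ℤ._+_ (cong₂ ℤ._*_ (a≗ 0) (b≗ (suc i))) (conv-cong (a≗ ∘ suc) b≗ i)

conv-+ˡ : ∀ a a′ b i → conv (λ j → a j ℤ.+ a′ j) b i ≡ conv a b i ℤ.+ conv a′ b i
conv-+ˡ a a′ b zero    = ℤ.*-distribʳ-+ (b 0) (a 0) (a′ 0)
conv-+ˡ a a′ b (suc i) rewrite conv-+ˡ (a ∘ suc) (a′ ∘ suc) b i =
  lemma (a 0) (a′ 0) (b (suc i)) _ _
  where
  lemma : ∀ x x′ y u v → (x ℤ.+ x′) ℤ.* y ℤ.+ (u ℤ.+ v) ≡ (x ℤ.* y ℤ.+ u) ℤ.+ (x′ ℤ.* y ℤ.+ v)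
  lemma = solve-∀

conv--ˡ : ∀ a a′ b i → conv (λ j → a j ℤ.- a′ j) b i ≡ conv a b i ℤ.- conv a′ b i
conv--ˡ a a′ b zero    = lemma (a 0) (a′ 0) (b 0)
  where
  lemma : ∀ x x′ y → (x ℤ.- x′) ℤ.* y ≡ x ℤ.* y ℤ.- x′ ℤ.* y
  lemma = solve-∀
conv--ˡ a a′ b (suc i) rewrite conv--ˡ (a ∘ suc) (a′ ∘ suc) b i =
  lemma (a 0) (a′ 0) (b (suc i)) _ _
  where
  lemma : ∀ x x′ y u v → (x ℤ.- x′) ℤ.* y ℤ.+ (u ℤ.- v) ≡ (x ℤ.* y ℤ.+ u) ℤ.- (x′ ℤ.* y ℤ.+ v)
  lemma = solve-∀

conv--ʳ : ∀ a b b′ i → conv a (λ j → b j ℤ.- b′ j) i ≡ conv a b i ℤ.- conv a b′ i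
conv--ʳ a b b′ zero    = lemma (a 0) (b 0) (b′ 0)
  where
  lemma : ∀ x y y′ → x ℤ.* (y ℤ.- y′) ≡ x ℤ.* y ℤ.- x ℤ.* y′
  lemma = solve-∀
conv--ʳ a b b′ (suc i) rewrite conv--ʳ (a ∘ suc) b b′ i =
  lemma (a 0) (b (suc i)) (b′ (suc i)) _ _
  where
  lemma : ∀ x y y′ u v → x ℤ.* (y ℤ.- y′) ℤ.+ (u ℤ.- v) ≡ (x ℤ.* y ℤ.+ u) ℤ.- (x ℤ.* y′ ℤ.+ v)
  lemma = solve-∀

conv-identityˡ : ∀ b → conv (coeff 1ₚ) b ≗ b
conv-identityˡ b zero    = ℤ.*-identityˡ (b 0)
conv-identityˡ b (suc i) =
  trans (cong₂ ℤ._+_ (ℤ.*-identityˡ (b (suc i))) (conv-zeroˡ b i)) (ℤ.+-identityʳ _)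

conv-identityʳ : ∀ a → conv a (coeff 1ₚ) ≗ a
conv-identityʳ a zero    = ℤ.*-identityʳ (a 0)
conv-identityʳ a (suc i) =
  trans (cong₂ ℤ._+_ (ℤ.*-zeroʳ (a 0)) (conv-identityʳ (a ∘ suc) i)) (ℤ.+-identityˡ _)

coeff-*ₚ : ∀ f g → coeff (f *ₚ g) ≗ conv (coeff f) (coeff g)
coeff-*ₚ []      g i    = sym (conv-zeroˡ (coeff g) i)
coeff-*ₚ (a ∷ f) g zero = trans (coeff-+ₚ (List.map (a ℤ.*_) g) _ 0)
  (trans (ℤ.+-identityʳ _) (coeff-scale a g 0))
coeff-*ₚ (a ∷ f) g (suc i) = trans (coeff-+ₚ (List.map (a ℤ.*_) g) _ (suc i))
  (cong₂ ℤ._+_ (coeff-scale a g (suc i)) (coeff-*ₚ f g i))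

-- With powers of 1 + X for `f` and `g`, the right-hand side has the shape of the
-- inclusion-exclusion count of totally dominating sets.
coeff-[f-1]*[g-1] : ∀ f g i → coeff ((f -ₚ 1ₚ) *ₚ (g -ₚ 1ₚ)) i
  ≡ coeff (f *ₚ g) i ℤ.- coeff f i ℤ.- coeff g i ℤ.+ coeff 1ₚ i
coeff-[f-1]*[g-1] f g i = begin
  coeff ((f -ₚ 1ₚ) *ₚ (g -ₚ 1ₚ)) i
    ≡⟨ coeff-*ₚ (f -ₚ 1ₚ) (g -ₚ 1ₚ) i ⟩
  conv (coeff (f -ₚ 1ₚ)) (coeff (g -ₚ 1ₚ)) i
    ≡⟨ conv-cong (coeff--ₚ f 1ₚ) (coeff--ₚ g 1ₚ) i ⟩
  conv (λ j → F j ℤ.- I j) (λ j → G j ℤ.- I j) i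
    ≡⟨ conv--ˡ F I _ i ⟩
  conv F (λ j → G j ℤ.- I j) i ℤ.- conv I (λ j → G j ℤ.- I j) i
    ≡⟨ cong₂ ℤ._-_ (conv--ʳ F G I i) (conv-identityˡ _ i) ⟩
  (conv F G i ℤ.- conv F I i) ℤ.- (G i ℤ.- I i)
    ≡⟨ cong₂ (λ x y → (x ℤ.- y) ℤ.- (G i ℤ.- I i)) (sym (coeff-*ₚ f g i)) (conv-identityʳ F i) ⟩
  (coeff (f *ₚ g) i ℤ.- F i) ℤ.- (G i ℤ.- I i)
    ≡⟨ lemma (coeff (f *ₚ g) i) (F i) (G i) (I i) ⟩
  coeff (f *ₚ g) i ℤ.- F i ℤ.- G i ℤ.+ I i ∎
  where
  open ≡-Reasoning
  F = coeff f
  G = coeff g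
  I = coeff 1ₚ
  lemma : ∀ x y z w → (x ℤ.- y) ℤ.- (z ℤ.- w) ≡ x ℤ.- y ℤ.- z ℤ.+ w
  lemma = solve-∀

coeff-[1+X]*-zero : ∀ f → coeff ((1ₚ +ₚ X) *ₚ f) 0 ≡ coeff f 0
coeff-[1+X]*-zero f = trans (coeff-*ₚ (1ₚ +ₚ X) f 0) (ℤ.*-identityˡ _)

-- Pascal's rule; it matches the split of subsets by whether they contain a given point.
coeff-[1+X]*-suc : ∀ f i → coeff ((1ₚ +ₚ X) *ₚ f) (suc i) ≡ coeff f (suc i) ℤ.+ coeff f i
coeff-[1+X]*-suc f i = trans (coeff-*ₚ (1ₚ +ₚ X) f (suc i))
  (cong₂ ℤ._+_ (ℤ.*-identityˡ (coeff f (suc i))) (conv-identityˡ (coeff f) i))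

coeff-X*-zero : ∀ f → coeff (X *ₚ f) 0 ≡ 0ℤ
coeff-X*-zero f = coeff-*ₚ X f 0

coeff-X*-suc : ∀ f i → coeff (X *ₚ f) (suc i) ≡ coeff f i
coeff-X*-suc f i = trans (coeff-*ₚ X f (suc i))
  (trans (ℤ.+-identityˡ _) (conv-identityˡ (coeff f) i))

-- The instance of associativity behind the induction in `[1+X]^-+`: multiplying by 1 + X adds a
-- shifted copy, and `conv` is additive in its left argument.
[1+X]*-assoc : ∀ f g → (1ₚ +ₚ X) *ₚ f *ₚ g ≈ₚ (1ₚ +ₚ X) *ₚ (f *ₚ g)
[1+X]*-assoc f g zero = begin
  coeff ((1ₚ +ₚ X) *ₚ f *ₚ g) 0           ≡⟨ coeff-*ₚ ((1ₚ +ₚ X) *ₚ f) g 0 ⟩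
  coeff ((1ₚ +ₚ X) *ₚ f) 0 ℤ.* coeff g 0  ≡⟨ cong (ℤ._* coeff g 0) (coeff-[1+X]*-zero f) ⟩
  coeff f 0 ℤ.* coeff g 0                 ≡⟨ coeff-*ₚ f g 0 ⟨
  coeff (f *ₚ g) 0                        ≡⟨ coeff-[1+X]*-zero (f *ₚ g) ⟨
  coeff ((1ₚ +ₚ X) *ₚ (f *ₚ g)) 0         ∎
  where open ≡-Reasoning
[1+X]*-assoc f g (suc i) = begin
  coeff ((1ₚ +ₚ X) *ₚ f *ₚ g) (suc i)
    ≡⟨ coeff-*ₚ ((1ₚ +ₚ X) *ₚ f) g (suc i) ⟩
  coeff ((1ₚ +ₚ X) *ₚ f) 0 ℤ.* G (suc i) ℤ.+ conv (coeff ((1ₚ +ₚ X) *ₚ f) ∘ suc) G i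
    ≡⟨ cong₂ ℤ._+_ (cong (ℤ._* G (suc i)) (coeff-[1+X]*-zero f))
         (conv-cong {b = G} (coeff-[1+X]*-suc f) (λ _ → refl) i) ⟩
  F 0 ℤ.* G (suc i) ℤ.+ conv (λ j → F (suc j) ℤ.+ F j) G i
    ≡⟨ cong (λ z → F 0 ℤ.* G (suc i) ℤ.+ z) (conv-+ˡ (F ∘ suc) F G i) ⟩
  F 0 ℤ.* G (suc i) ℤ.+ (conv (F ∘ suc) G i ℤ.+ conv F G i)
    ≡⟨ ℤ.+-assoc (F 0 ℤ.* G (suc i)) _ _ ⟨
  conv F G (suc i) ℤ.+ conv F G i
    ≡⟨ cong₂ ℤ._+_ (coeff-*ₚ f g (suc i)) (coeff-*ₚ f g i) ⟨
  coeff (f *ₚ g) (suc i) ℤ.+ coeff (f *ₚ g) i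
    ≡⟨ coeff-[1+X]*-suc (f *ₚ g) i ⟨
  coeff ((1ₚ +ₚ X) *ₚ (f *ₚ g)) (suc i) ∎
  where
  open ≡-Reasoning
  F = coeff f
  G = coeff g

*ₚ-congˡ : ∀ h f g → f ≈ₚ g → h *ₚ f ≈ₚ h *ₚ g
*ₚ-congˡ h f g f≈g i = trans (coeff-*ₚ h f i)
  (trans (conv-cong {a = coeff h} (λ _ → refl) f≈g i) (sym (coeff-*ₚ h g i)))

[1+X]^-+ : ∀ a b → (1ₚ +ₚ X) ^ₚ a *ₚ (1ₚ +ₚ X) ^ₚ b ≈ₚ (1ₚ +ₚ X) ^ₚ (a ℕ.+ b)
[1+X]^-+ zero    b i = trans (coeff-*ₚ 1ₚ ((1ₚ +ₚ X) ^ₚ b) i) (conv-identityˡ _ i)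
[1+X]^-+ (suc a) b i = trans ([1+X]*-assoc ((1ₚ +ₚ X) ^ₚ a) _ i)
  (*ₚ-congˡ (1ₚ +ₚ X) ((1ₚ +ₚ X) ^ₚ a *ₚ (1ₚ +ₚ X) ^ₚ b) ((1ₚ +ₚ X) ^ₚ (a ℕ.+ b)) ([1+X]^-+ a b) i)

-- Past the end of the list `coeff` returns 0 by default, so `f` itself must vanish from `m` on.
coeff-applyUpTo : ∀ (f : ℕ → ℤ) m → (∀ i → m ℕ.≤ i → f i ≡ 0ℤ) →
  ∀ i → coeff (applyUpTo f m) i ≡ f i
coeff-applyUpTo f zero    f≡0 i       = sym (f≡0 i z≤n)
coeff-applyUpTo f (suc m) f≡0 zero    = refl
coeff-applyUpTo f (suc m) f≡0 (suc i) =
  coeff-applyUpTo (f ∘ suc) m (λ j m≤j → f≡0 (suc j) (s≤s m≤j)) i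

-- Indicators, and sums over all subsets

-- Only the `does` field is read, so equivalent propositions have equal indicators whatever their
-- deciders.
⟦_⟧ : Dec P → ℤ
⟦ p? ⟧ = if does p? then 1ℤ else 0ℤ

⟦⟧-⇔ : P ⇔ Q → (p? : Dec P) (q? : Dec Q) → ⟦ p? ⟧ ≡ ⟦ q? ⟧
⟦⟧-⇔ P⇔Q p? q? = cong (if_then 1ℤ else 0ℤ) (does-⇔ P⇔Q p? q?)

⟦⟧-false : (p? : Dec P) → ¬ P → ⟦ p? ⟧ ≡ 0ℤ
⟦⟧-false p? ¬p = cong (if_then 1ℤ else 0ℤ) (dec-false p? ¬p)

⟦⟧-× : (p? : Dec P) (q? : Dec Q) → ⟦ p? ×-dec q? ⟧ ≡ ⟦ p? ⟧ ℤ.* ⟦ q? ⟧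
⟦⟧-× (yes _) q? = sym (ℤ.*-identityˡ _)
⟦⟧-× (no _)  q? = refl

⟦⟧-⊎ : (p? : Dec P) (q? : Dec Q) → (P → ¬ Q) → ⟦ p? ⊎-dec q? ⟧ ≡ ⟦ p? ⟧ ℤ.+ ⟦ q? ⟧
⟦⟧-⊎ (yes p) (yes q) P∩Q = contradiction q (P∩Q p)
⟦⟧-⊎ (yes _) (no _)  _   = refl
⟦⟧-⊎ (no _)  q?      _   = sym (ℤ.+-identityˡ _)

-- This is [P](1 - [Q])(1 - [R]) expanded; Q and R imply P and so absorb the factor [P].
⟦⟧-inclusion–exclusion : (v? : Dec P) (a? : Dec Q) (b? : Dec R) → (Q → P) → (R → P) →
  ⟦ v? ×-dec ¬? a? ×-dec ¬? b? ⟧ ≡ ⟦ v? ⟧ ℤ.- ⟦ a? ⟧ ℤ.- ⟦ b? ⟧ ℤ.+ ⟦ a? ×-dec b? ⟧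
⟦⟧-inclusion–exclusion (no ¬v) (yes a) _       a⇒v _   = contradiction (a⇒v a) ¬v
⟦⟧-inclusion–exclusion (no ¬v) (no _)  (yes b) _   b⇒v = contradiction (b⇒v b) ¬v
⟦⟧-inclusion–exclusion (no _)  (no _)  (no _)  _   _   = refl
⟦⟧-inclusion–exclusion (yes _) (yes _) (yes _) _   _   = refl
⟦⟧-inclusion–exclusion (yes _) (yes _) (no _)  _   _   = refl
⟦⟧-inclusion–exclusion (yes _) (no _)  (yes _) _   _   = refl
⟦⟧-inclusion–exclusion (yes _) (no _)  (no _)  _   _   = refl

-- Recursion on the first position, in step with `subsets`, so that identities reduce to the halves
-- without and with that point.
Σₛ : (Subset n → ℤ) → ℤ
Σₛ {zero}  f = f []
Σₛ {suc n} f = Σₛ (f ∘ (outside ∷_)) ℤ.+ Σₛ (f ∘ (inside ∷_))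

Σₛ-cong : {f g : Subset n → ℤ} → f ≗ g → Σₛ f ≡ Σₛ g
Σₛ-cong {zero}  f≗g = f≗g []
Σₛ-cong {suc n} f≗g = cong₂ ℤ._+_ (Σₛ-cong (f≗g ∘ (outside ∷_))) (Σₛ-cong (f≗g ∘ (inside ∷_)))

Σₛ-zero : {f : Subset n → ℤ} → (∀ S → f S ≡ 0ℤ) → Σₛ f ≡ 0ℤ
Σₛ-zero {zero}  f≡0 = f≡0 []
Σₛ-zero {suc n} f≡0 = cong₂ ℤ._+_ (Σₛ-zero (f≡0 ∘ (outside ∷_))) (Σₛ-zero (f≡0 ∘ (inside ∷_)))

Σₛ-+ : (f g : Subset n → ℤ) → Σₛ (λ S → f S ℤ.+ g S) ≡ Σₛ f ℤ.+ Σₛ g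
Σₛ-+ {zero}  f g = refl
Σₛ-+ {suc n} f g = trans (cong₂ ℤ._+_ (Σₛ-+ (f ∘ (outside ∷_)) (g ∘ (outside ∷_)))
                                     (Σₛ-+ (f ∘ (inside ∷_)) (g ∘ (inside ∷_))))
  (lemma (Σₛ (f ∘ (outside ∷_))) _ _ _)
  where
  lemma : ∀ a b c e → (a ℤ.+ b) ℤ.+ (c ℤ.+ e) ≡ (a ℤ.+ c) ℤ.+ (b ℤ.+ e)
  lemma = solve-∀

Σₛ-- : (f g : Subset n → ℤ) → Σₛ (λ S → f S ℤ.- g S) ≡ Σₛ f ℤ.- Σₛ g
Σₛ-- {zero}  f g = refl
Σₛ-- {suc n} f g = trans (cong₂ ℤ._+_ (Σₛ-- (f ∘ (outside ∷_)) (g ∘ (outside ∷_)))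
                                     (Σₛ-- (f ∘ (inside ∷_)) (g ∘ (inside ∷_))))
  (lemma (Σₛ (f ∘ (outside ∷_))) _ _ _)
  where
  lemma : ∀ a b c e → (a ℤ.- b) ℤ.+ (c ℤ.- e) ≡ (a ℤ.+ c) ℤ.- (b ℤ.+ e)
  lemma = solve-∀

length-filter-map : ∀ {A B : Set} {P : Pred B 0ℓ} (P? : Decidable P) (f : A → B) xs →
  length (filter P? (List.map f xs)) ≡ length (filter (P? ∘ f) xs)
length-filter-map P? f []       = refl
length-filter-map P? f (x ∷ xs) with does (P? (f x))
... | true  = cong suc (length-filter-map P? f xs)
... | false = length-filter-map P? f xs

length-filter-subsets : {P : Pred (Subset n) 0ℓ} (P? : Decidable P) →
  + length (filter P? (subsets n)) ≡ Σₛ (λ S → ⟦ P? S ⟧)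
length-filter-subsets {zero}  P? with does (P? [])
... | true  = refl
... | false = refl
length-filter-subsets {suc n} P? = begin
  + length (filter P? (outs ++ ins))
    ≡⟨ cong (+_ ∘ length) (filter-++ P? outs ins) ⟩
  + length (filter P? outs ++ filter P? ins)
    ≡⟨ cong +_ (length-++ (filter P? outs)) ⟩
  + length (filter P? outs) ℤ.+ + length (filter P? ins)
    ≡⟨ cong₂ (λ x y → + x ℤ.+ + y) (length-filter-map P? (outside ∷_) (subsets n))
                                   (length-filter-map P? (inside ∷_) (subsets n)) ⟩
  + length (filter (P? ∘ (outside ∷_)) (subsets n)) ℤ.+
  + length (filter (P? ∘ (inside ∷_)) (subsets n))
    ≡⟨ cong₂ ℤ._+_ (length-filter-subsets (P? ∘ (outside ∷_)))
                   (length-filter-subsets (P? ∘ (inside ∷_))) ⟩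
  Σₛ (λ S → ⟦ P? S ⟧) ∎
  where
  open ≡-Reasoning
  outs = List.map (outside ∷_) (subsets n)
  ins  = List.map (inside ∷_) (subsets n)

_≟ₛ_ : (S W : Subset n) → Dec (S ≡ W)
_≟ₛ_ = Vec.≡-dec Bool._≟_

-- In the half whose first entry agrees with that of `W` the comparison passes to the tails; the
-- other half contributes nothing.
Σₛ-δ : (W : Subset n) (f : Subset n → ℤ) → Σₛ (λ S → ⟦ S ≟ₛ W ⟧ ℤ.* f S) ≡ f W
Σₛ-δ []      f = ℤ.*-identityˡ (f [])
Σₛ-δ (x ∷ W) f = split x
  where
  keep : ∀ s → Σₛ (λ S → ⟦ (s ∷ S) ≟ₛ (s ∷ W) ⟧ ℤ.* f (s ∷ S)) ≡ f (s ∷ W)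
  keep s = trans
    (Σₛ-cong λ S → cong (ℤ._* f (s ∷ S))
      (⟦⟧-⇔ (mk⇔ Vec.∷-injectiveʳ (cong (s ∷_))) ((s ∷ S) ≟ₛ (s ∷ W)) (S ≟ₛ W)))
    (Σₛ-δ W (f ∘ (s ∷_)))
  drop : ∀ s t → s ≢ t → Σₛ (λ S → ⟦ (s ∷ S) ≟ₛ (t ∷ W) ⟧ ℤ.* f (s ∷ S)) ≡ 0ℤ
  drop s t s≢t = Σₛ-zero λ S → cong (ℤ._* f (s ∷ S))
    (⟦⟧-false ((s ∷ S) ≟ₛ (t ∷ W)) (s≢t ∘ Vec.∷-injectiveˡ))
  split : ∀ x → Σₛ (λ S → ⟦ S ≟ₛ (x ∷ W) ⟧ ℤ.* f S) ≡ f (x ∷ W)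
  split inside  = trans (cong₂ ℤ._+_ (drop outside inside λ ()) (keep inside)) (ℤ.+-identityˡ _)
  split outside = trans (cong₂ ℤ._+_ (keep outside) (drop inside outside λ ())) (ℤ.+-identityʳ _)

⟦≟⟧-suc : ∀ m i → ⟦ suc m ℕ.≟ suc i ⟧ ≡ ⟦ m ℕ.≟ i ⟧
⟦≟⟧-suc m i = ⟦⟧-⇔ (mk⇔ ℕ.suc-injective (cong suc)) (suc m ℕ.≟ suc i) (m ℕ.≟ i)

coeff-X^ : ∀ k i → coeff (X ^ₚ k) i ≡ ⟦ k ℕ.≟ i ⟧
coeff-X^ zero    zero    = refl
coeff-X^ zero    (suc i) = refl
coeff-X^ (suc k) zero    = coeff-X*-zero (X ^ₚ k)
coeff-X^ (suc k) (suc i) =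
  trans (coeff-X*-suc (X ^ₚ k) i) (trans (coeff-X^ k i) (sym (⟦≟⟧-suc k i)))

-- A point outside `W` leaves the generating function unchanged, since only the half without it
-- counts; a point of `W` multiplies it by 1 + X.
Σₛ-⊆ : (W : Subset n) (i : ℕ) →
  Σₛ (λ S → ⟦ S ⊆? W ⟧ ℤ.* ⟦ ∣ S ∣ ℕ.≟ i ⟧) ≡ coeff ((1ₚ +ₚ X) ^ₚ ∣ W ∣) i
Σₛ-⊆ []            zero    = refl
Σₛ-⊆ []            (suc i) = refl
Σₛ-⊆ {suc n} (outside ∷ W) i = trans
  -- The Boolean of `_⊆?_` computes: omitting the first point leaves that of `S ⊆? W`, including it
  -- gives false.
  (cong₂ ℤ._+_ (Σₛ-⊆ W i) (Σₛ-zero {n} λ S → refl)) (ℤ.+-identityʳ _)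
Σₛ-⊆ {suc n} (inside ∷ W) zero = trans
  (cong₂ ℤ._+_ (Σₛ-⊆ W 0) (Σₛ-zero {n} λ S → ℤ.*-zeroʳ ⟦ S ⊆? W ⟧))
  (trans (ℤ.+-identityʳ _) (sym (coeff-[1+X]*-zero ((1ₚ +ₚ X) ^ₚ ∣ W ∣))))
Σₛ-⊆ {suc n} (inside ∷ W) (suc i) = trans
  (cong₂ ℤ._+_ (Σₛ-⊆ W (suc i))
    (trans (Σₛ-cong {n} λ S → cong (⟦ S ⊆? W ⟧ ℤ.*_) (⟦≟⟧-suc ∣ S ∣ i)) (Σₛ-⊆ W i)))
  (sym (coeff-[1+X]*-suc ((1ₚ +ₚ X) ^ₚ ∣ W ∣) i))

-- The list stops at degree `∣ V ∣`; as `P S` forces `S ⊆ V`, every later count is zero, like the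
-- default coefficient.
coeff-count : {P : Pred (Subset n) 0ℓ} (P? : Decidable P) {V : Subset n} → (∀ {S} → P S → S ⊆ V) →
  ∀ i → coeff (List.map (λ j → + length (filter (λ S → P? S ×-dec (∣ S ∣ ℕ.≟ j)) (subsets n)))
                        (upTo (suc ∣ V ∣))) i
        ≡ Σₛ (λ S → ⟦ P? S ⟧ ℤ.* ⟦ ∣ S ∣ ℕ.≟ i ⟧)
coeff-count {n} P? {V} P⇒⊆V i = begin
  coeff (List.map count (upTo (suc ∣ V ∣))) i
    ≡⟨ cong (λ l → coeff l i) (map-upTo count (suc ∣ V ∣)) ⟩
  coeff (applyUpTo count (suc ∣ V ∣)) i
    ≡⟨ coeff-applyUpTo count (suc ∣ V ∣) count≡0 i ⟩
  count i
    ≡⟨ count≡ i ⟩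
  Σₛ (λ S → ⟦ P? S ⟧ ℤ.* ⟦ ∣ S ∣ ℕ.≟ i ⟧) ∎
  where
  open ≡-Reasoning
  count : ℕ → ℤ
  count j = + length (filter (λ S → P? S ×-dec (∣ S ∣ ℕ.≟ j)) (subsets n))
  count≡ : ∀ j → count j ≡ Σₛ (λ S → ⟦ P? S ⟧ ℤ.* ⟦ ∣ S ∣ ℕ.≟ j ⟧)
  count≡ j = trans (length-filter-subsets (λ S → P? S ×-dec (∣ S ∣ ℕ.≟ j)))
    (Σₛ-cong λ S → ⟦⟧-× (P? S) (∣ S ∣ ℕ.≟ j))
  count≡0 : ∀ j → suc ∣ V ∣ ℕ.≤ j → count j ≡ 0ℤ
  count≡0 j V<j = trans (length-filter-subsets (λ S → P? S ×-dec (∣ S ∣ ℕ.≟ j)))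
    (Σₛ-zero λ S → ⟦⟧-false (P? S ×-dec (∣ S ∣ ℕ.≟ j)) λ (PS , S≡j) →
      ℕ.<⇒≱ V<j (subst (ℕ._≤ ∣ V ∣) S≡j (p⊆q⇒∣p∣≤∣q∣ (P⇒⊆V PS))))

-- Complete bipartite graphs

∣∪∣-disjoint : (p q : Subset n) → (∀ {x} → x ∈ p → x ∉ q) → ∣ p ∪ q ∣ ≡ ∣ p ∣ ℕ.+ ∣ q ∣
∣∪∣-disjoint []            []            _   = refl
∣∪∣-disjoint (inside ∷ p)  (inside ∷ q)  p∩q = contradiction here (p∩q here)
∣∪∣-disjoint (inside ∷ p)  (outside ∷ q) p∩q =
  cong suc (∣∪∣-disjoint p q λ x∈p x∈q → p∩q (there x∈p) (there x∈q))
∣∪∣-disjoint (outside ∷ p) (inside ∷ q)  p∩q = trans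
  (cong suc (∣∪∣-disjoint p q λ x∈p x∈q → p∩q (there x∈p) (there x∈q)))
  (sym (ℕ.+-suc ∣ p ∣ ∣ q ∣))
∣∪∣-disjoint (outside ∷ p) (outside ∷ q) p∩q =
  ∣∪∣-disjoint p q λ x∈p x∈q → p∩q (there x∈p) (there x∈q)

⊈⇒∃ : {p q : Subset n} → ¬ p ⊆ q → ∃ λ x → x ∈ p × x ∉ q
⊈⇒∃ {p = p} {q} p⊈q = decidable-stable (any? λ x → (x ∈? p) ×-dec ¬? (x ∈? q))
  λ none → p⊈q λ {x} x∈p → decidable-stable (x ∈? q) λ x∉q → none (x , x∈p , x∉q)

-- Both parts are nonempty: an empty part would not dominate a nonempty one, and without vertices
-- the empty set would be totally dominating.
record CompleteBipartite (G : Graph) (A B : Subset (Graph.size G)) : Set where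
  open Graph G
  field
    partition    : V ≡ A ∪ B
    disjoint     : ∀ {u} → u ∈ A → u ∉ B
    adjacent     : ∀ {u v} → u ∈ A → v ∈ B → u ~ v
    independentˡ : ∀ {u v} → u ∈ A → v ∈ A → ¬ u ~ v
    independentʳ : ∀ {u v} → u ∈ B → v ∈ B → ¬ u ~ v
    nonemptyˡ    : Nonempty A
    nonemptyʳ    : Nonempty B

-- By this symmetry each fact proved for the first part also serves for the second.
flip : ∀ {G A B} → CompleteBipartite G A B → CompleteBipartite G B A
flip {G} {A} {B} K = record
  { partition    = trans partition (∪-comm A B)
  ; disjoint     = λ u∈B u∈A → disjoint u∈A u∈B
  ; adjacent     = λ u∈B v∈A → ~-sym (adjacent v∈A u∈B)
  ; independentˡ = independentʳ
  ; independentʳ = independentˡ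
  ; nonemptyˡ    = nonemptyʳ
  ; nonemptyʳ    = nonemptyˡ
  }
  where
  open Graph G
  open CompleteBipartite K

module _ {G : Graph} {A B : Subset (Graph.size G)} (K : CompleteBipartite G A B) where
  open Graph G
  open CompleteBipartite K

  partˡ⊆V : A ⊆ V
  partˡ⊆V v∈A = subst (_ ∈_) (sym partition) (x∈p∪q⁺ (inj₁ v∈A))

  ∈V⇒∈parts : ∀ {v} → v ∈ V → v ∈ A ⊎ v ∈ B
  ∈V⇒∈parts v∈V = x∈p∪q⁻ A B (subst (_ ∈_) partition v∈V)

  ⊈partˡ⇒meets-partʳ : ∀ {S} → S ⊆ V → ¬ S ⊆ A → ∃ λ u → u ∈ S × u ∈ B
  ⊈partˡ⇒meets-partʳ S⊆V S⊈A with ⊈⇒∃ S⊈A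
  ... | u , u∈S , u∉A = u , u∈S , [ (λ u∈A → contradiction u∈A u∉A) , (λ u∈B → u∈B) ]′ (∈V⇒∈parts (S⊆V u∈S))

  -- `A` is independent, so a vertex of `A` has no neighbour inside a subset of `A`.
  total⇒⊈partˡ : ∀ {S} → TotalDominating G S → ¬ S ⊆ A
  total⇒⊈partˡ (_ , dom) S⊆A with nonemptyˡ
  ... | a , a∈A with dom a (partˡ⊆V a∈A)
  ... | u , u∈S , a~u = independentˡ a∈A (S⊆A u∈S) a~u

  -- A vertex of `A` left out of `S` would need a neighbour in `S`, hence in `A`, against
  -- independence.
  dominating⊆partˡ⇒≡ : ∀ {S} → Dominating G S → S ⊆ A → S ≡ A
  dominating⊆partˡ⇒≡ {S} (_ , dom) S⊆A = ⊆-antisym S⊆A λ {v} v∈A →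
    decidable-stable (v ∈? S) λ v∉S →
      let u , u∈S , v~u = dom v (partˡ⊆V v∈A) v∉S in independentˡ v∈A (S⊆A u∈S) v~u

  partˡ-dominating : Dominating G A
  partˡ-dominating = partˡ⊆V , λ v v∈V v∉A →
    let a , a∈A = nonemptyˡ in
    a , a∈A , [ (λ v∈A → contradiction v∈A v∉A) , (λ v∈B → ~-sym (adjacent a∈A v∈B)) ]′ (∈V⇒∈parts v∈V)

module _ {G : Graph} {A B : Subset (Graph.size G)} (K : CompleteBipartite G A B) where
  open Graph G
  open CompleteBipartite K

  -- A set inside `V` and inside neither part meets both; one element `b` in `B` dominates all of
  -- `A`, and one element `a` in `A` dominates all of `B`.
  totalDominating⇔ : ∀ {S} → TotalDominating G S ⇔ (S ⊆ V × ¬ S ⊆ A × ¬ S ⊆ B)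
  totalDominating⇔ {S} = mk⇔
    (λ tot → proj₁ tot , total⇒⊈partˡ K tot , total⇒⊈partˡ (flip K) tot)
    λ (S⊆V , S⊈A , S⊈B) →
      let a , a∈S , a∈A = ⊈partˡ⇒meets-partʳ (flip K) S⊆V S⊈B
          b , b∈S , b∈B = ⊈partˡ⇒meets-partʳ K S⊆V S⊈A
      in S⊆V , λ v v∈V → [ (λ v∈A → b , b∈S , adjacent v∈A b∈B)
                         , (λ v∈B → a , a∈S , ~-sym (adjacent a∈A v∈B)) ]′ (∈V⇒∈parts K v∈V)

  dominating⇔ : ∀ {S} → Dominating G S ⇔ (TotalDominating G S ⊎ S ≡ A ⊎ S ≡ B)
  dominating⇔ {S} = mk⇔ to from
    where
    to : Dominating G S → TotalDominating G S ⊎ S ≡ A ⊎ S ≡ B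
    to dom with S ⊆? A | S ⊆? B
    ... | yes S⊆A | _       = inj₂ (inj₁ (dominating⊆partˡ⇒≡ K dom S⊆A))
    ... | no _    | yes S⊆B = inj₂ (inj₂ (dominating⊆partˡ⇒≡ (flip K) dom S⊆B))
    ... | no S⊈A  | no S⊈B  =
      inj₁ (Equivalence.from totalDominating⇔ (proj₁ dom , S⊈A , S⊈B))
    from : TotalDominating G S ⊎ S ≡ A ⊎ S ≡ B → Dominating G S
    from (inj₁ (S⊆V , tot))  = S⊆V , λ v v∈V _ → tot v v∈V
    from (inj₂ (inj₁ refl)) = partˡ-dominating K
    from (inj₂ (inj₂ refl)) = partˡ-dominating (flip K)

  ⟦totalDominating⟧ : ∀ S → ⟦ totalDominating? G S ⟧
    ≡ ⟦ S ⊆? V ⟧ ℤ.- ⟦ S ⊆? A ⟧ ℤ.- ⟦ S ⊆? B ⟧ ℤ.+ ⟦ S ⊆? ∅ ⟧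
  ⟦totalDominating⟧ S = begin
    ⟦ totalDominating? G S ⟧
      ≡⟨ ⟦⟧-⇔ totalDominating⇔ (totalDominating? G S) (v? ×-dec ¬? a? ×-dec ¬? b?) ⟩
    ⟦ v? ×-dec ¬? a? ×-dec ¬? b? ⟧
      ≡⟨ ⟦⟧-inclusion–exclusion v? a? b? (λ S⊆A → ⊆-trans S⊆A (partˡ⊆V K))
                                          (λ S⊆B → ⊆-trans S⊆B (partˡ⊆V (flip K))) ⟩
    ⟦ v? ⟧ ℤ.- ⟦ a? ⟧ ℤ.- ⟦ b? ⟧ ℤ.+ ⟦ a? ×-dec b? ⟧
      -- By disjointness, lying in both parts means being empty; the form `S ⊆ ∅` lets `Σₛ-⊆` treat
      -- all four terms alike.
      ≡⟨ cong (λ z → ⟦ v? ⟧ ℤ.- ⟦ a? ⟧ ℤ.- ⟦ b? ⟧ ℤ.+ z) (⟦⟧-⇔ ⊆A∩B⇔⊆∅ (a? ×-dec b?) (S ⊆? ∅)) ⟩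
    ⟦ v? ⟧ ℤ.- ⟦ a? ⟧ ℤ.- ⟦ b? ⟧ ℤ.+ ⟦ S ⊆? ∅ ⟧ ∎
    where
    open ≡-Reasoning
    v? = S ⊆? V
    a? = S ⊆? A
    b? = S ⊆? B
    ⊆A∩B⇔⊆∅ : (S ⊆ A × S ⊆ B) ⇔ S ⊆ ∅
    ⊆A∩B⇔⊆∅ = mk⇔ to from
      where
      to : S ⊆ A × S ⊆ B → S ⊆ ∅
      to (S⊆A , S⊆B) x∈S = contradiction (S⊆B x∈S) (disjoint (S⊆A x∈S))
      from : S ⊆ ∅ → S ⊆ A × S ⊆ B
      from S⊆∅ = (λ x∈S → contradiction (S⊆∅ x∈S) ∉⊥) , (λ x∈S → contradiction (S⊆∅ x∈S) ∉⊥)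

  -- The three alternatives exclude each other: a part is not totally dominating, and `A` has an
  -- element that is not in `B`.
  ⟦dominating⟧ : ∀ S → ⟦ dominating? G S ⟧
    ≡ ⟦ totalDominating? G S ⟧ ℤ.+ (⟦ S ≟ₛ A ⟧ ℤ.+ ⟦ S ≟ₛ B ⟧)
  ⟦dominating⟧ S = begin
    ⟦ dominating? G S ⟧
      ≡⟨ ⟦⟧-⇔ dominating⇔ (dominating? G S) (t? ⊎-dec (a? ⊎-dec b?)) ⟩
    ⟦ t? ⊎-dec (a? ⊎-dec b?) ⟧
      ≡⟨ ⟦⟧-⊎ t? (a? ⊎-dec b?) (λ tot → [ total⇒⊈partˡ K tot ∘ ⊆-reflexive
                                         , total⇒⊈partˡ (flip K) tot ∘ ⊆-reflexive ]′) ⟩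
    ⟦ t? ⟧ ℤ.+ ⟦ a? ⊎-dec b? ⟧
      ≡⟨ cong (λ z → ⟦ t? ⟧ ℤ.+ z) (⟦⟧-⊎ a? b? λ S≡A S≡B →
           let a , a∈A = nonemptyˡ in disjoint a∈A (subst (a ∈_) (trans (sym S≡A) S≡B) a∈A)) ⟩
    ⟦ t? ⟧ ℤ.+ (⟦ a? ⟧ ℤ.+ ⟦ b? ⟧) ∎
    where
    open ≡-Reasoning
    t? = totalDominating? G S
    a? = S ≟ₛ A
    b? = S ≟ₛ B

  Σₛ-totalDominating : ∀ i → Σₛ (λ S → ⟦ totalDominating? G S ⟧ ℤ.* ⟦ ∣ S ∣ ℕ.≟ i ⟧)
    ≡ coeff (((1ₚ +ₚ X) ^ₚ ∣ A ∣ -ₚ 1ₚ) *ₚ ((1ₚ +ₚ X) ^ₚ ∣ B ∣ -ₚ 1ₚ)) i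
  Σₛ-totalDominating i = begin
    Σₛ (λ S → ⟦ totalDominating? G S ⟧ ℤ.* ⟦ ∣ S ∣ ℕ.≟ i ⟧)
      ≡⟨ Σₛ-cong (λ S → trans (cong (ℤ._* ⟦ ∣ S ∣ ℕ.≟ i ⟧) (⟦totalDominating⟧ S))
                              (distrib ⟦ S ⊆? V ⟧ _ _ _ ⟦ ∣ S ∣ ℕ.≟ i ⟧)) ⟩
    Σₛ (λ S → w V S ℤ.- w A S ℤ.- w B S ℤ.+ w ∅ S)
      ≡⟨ Σₛ-+ (λ S → w V S ℤ.- w A S ℤ.- w B S) (w ∅) ⟩
    Σₛ (λ S → w V S ℤ.- w A S ℤ.- w B S) ℤ.+ Σₛ (w ∅)
      ≡⟨ cong (ℤ._+ Σₛ (w ∅)) (trans (Σₛ-- (λ S → w V S ℤ.- w A S) (w B))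
           (cong (ℤ._- Σₛ (w B)) (Σₛ-- (w V) (w A)))) ⟩
    Σₛ (w V) ℤ.- Σₛ (w A) ℤ.- Σₛ (w B) ℤ.+ Σₛ (w ∅)
      ≡⟨ cong₂ ℤ._+_ (cong₂ ℤ._-_ (cong₂ ℤ._-_ (Σₛ-⊆ V i) (Σₛ-⊆ A i)) (Σₛ-⊆ B i)) (Σₛ-⊆ {size} ∅ i) ⟩
    c ∣ V ∣ ℤ.- c a ℤ.- c b ℤ.+ c k
      -- The parts are disjoint, so `V` has `a + b` elements; `∅` has none, and the zeroth power is
      -- `1ₚ`.
      ≡⟨ cong₂ (λ v e → c v ℤ.- c a ℤ.- c b ℤ.+ c e)
           (trans (cong ∣_∣ partition) (∣∪∣-disjoint A B disjoint)) (∣⊥∣≡0 size) ⟩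
    c (a ℕ.+ b) ℤ.- c a ℤ.- c b ℤ.+ coeff 1ₚ i
      ≡⟨ cong (λ z → z ℤ.- c a ℤ.- c b ℤ.+ coeff 1ₚ i) ([1+X]^-+ a b i) ⟨
    coeff ((1ₚ +ₚ X) ^ₚ a *ₚ (1ₚ +ₚ X) ^ₚ b) i ℤ.- c a ℤ.- c b ℤ.+ coeff 1ₚ i
      ≡⟨ coeff-[f-1]*[g-1] ((1ₚ +ₚ X) ^ₚ a) ((1ₚ +ₚ X) ^ₚ b) i ⟨
    coeff (((1ₚ +ₚ X) ^ₚ a -ₚ 1ₚ) *ₚ ((1ₚ +ₚ X) ^ₚ b -ₚ 1ₚ)) i ∎
    where
    open ≡-Reasoning
    a = ∣ A ∣
    b = ∣ B ∣
    k = ∣ ∅ {size} ∣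
    w : Subset size → Subset size → ℤ
    w W S = ⟦ S ⊆? W ⟧ ℤ.* ⟦ ∣ S ∣ ℕ.≟ i ⟧
    c : ℕ → ℤ
    c m = coeff ((1ₚ +ₚ X) ^ₚ m) i
    distrib : ∀ v a b e z → (v ℤ.- a ℤ.- b ℤ.+ e) ℤ.* z ≡ v ℤ.* z ℤ.- a ℤ.* z ℤ.- b ℤ.* z ℤ.+ e ℤ.* z
    distrib = solve-∀

  Dₜ-completeBipartite : Dₜ G ≈ₚ ((1ₚ +ₚ X) ^ₚ ∣ A ∣ -ₚ 1ₚ) *ₚ ((1ₚ +ₚ X) ^ₚ ∣ B ∣ -ₚ 1ₚ)
  Dₜ-completeBipartite i =
    trans (coeff-count (totalDominating? G) proj₁ i) (Σₛ-totalDominating i)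

  D-completeBipartite : D G ≈ₚ
    ((1ₚ +ₚ X) ^ₚ ∣ A ∣ -ₚ 1ₚ) *ₚ ((1ₚ +ₚ X) ^ₚ ∣ B ∣ -ₚ 1ₚ) +ₚ X ^ₚ ∣ A ∣ +ₚ X ^ₚ ∣ B ∣
  D-completeBipartite i = begin
    coeff (D G) i
      ≡⟨ coeff-count (dominating? G) proj₁ i ⟩
    Σₛ (λ S → ⟦ dominating? G S ⟧ ℤ.* s S)
      ≡⟨ Σₛ-cong (λ S → trans (cong (ℤ._* s S) (⟦dominating⟧ S))
                              (distrib ⟦ totalDominating? G S ⟧ ⟦ S ≟ₛ A ⟧ ⟦ S ≟ₛ B ⟧ (s S))) ⟩
    Σₛ (λ S → t S ℤ.+ ⟦ S ≟ₛ A ⟧ ℤ.* s S ℤ.+ ⟦ S ≟ₛ B ⟧ ℤ.* s S)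
      ≡⟨ trans (Σₛ-+ (λ S → t S ℤ.+ ⟦ S ≟ₛ A ⟧ ℤ.* s S) (λ S → ⟦ S ≟ₛ B ⟧ ℤ.* s S))
               (cong (ℤ._+ Σₛ (λ S → ⟦ S ≟ₛ B ⟧ ℤ.* s S)) (Σₛ-+ t (λ S → ⟦ S ≟ₛ A ⟧ ℤ.* s S))) ⟩
    Σₛ t ℤ.+ Σₛ (λ S → ⟦ S ≟ₛ A ⟧ ℤ.* s S) ℤ.+ Σₛ (λ S → ⟦ S ≟ₛ B ⟧ ℤ.* s S)
      ≡⟨ cong₂ ℤ._+_ (cong₂ ℤ._+_ (Σₛ-totalDominating i) (delta A)) (delta B) ⟩
    coeff E i ℤ.+ coeff (X ^ₚ ∣ A ∣) i ℤ.+ coeff (X ^ₚ ∣ B ∣) i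
      ≡⟨ cong (ℤ._+ coeff (X ^ₚ ∣ B ∣) i) (coeff-+ₚ E (X ^ₚ ∣ A ∣) i) ⟨
    coeff (E +ₚ X ^ₚ ∣ A ∣) i ℤ.+ coeff (X ^ₚ ∣ B ∣) i
      ≡⟨ coeff-+ₚ (E +ₚ X ^ₚ ∣ A ∣) (X ^ₚ ∣ B ∣) i ⟨
    coeff (E +ₚ X ^ₚ ∣ A ∣ +ₚ X ^ₚ ∣ B ∣) i ∎
    where
    open ≡-Reasoning
    E = ((1ₚ +ₚ X) ^ₚ ∣ A ∣ -ₚ 1ₚ) *ₚ ((1ₚ +ₚ X) ^ₚ ∣ B ∣ -ₚ 1ₚ)
    s t : Subset size → ℤ
    s S = ⟦ ∣ S ∣ ℕ.≟ i ⟧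
    t S = ⟦ totalDominating? G S ⟧ ℤ.* s S
    distrib : ∀ x a b z → (x ℤ.+ (a ℤ.+ b)) ℤ.* z ≡ x ℤ.* z ℤ.+ a ℤ.* z ℤ.+ b ℤ.* z
    distrib = solve-∀
    delta : ∀ W → Σₛ (λ S → ⟦ S ≟ₛ W ⟧ ℤ.* s S) ≡ coeff (X ^ₚ ∣ W ∣) i
    delta W = trans (Σₛ-δ W s) (sym (coeff-X^ ∣ W ∣ i))

-- The zero-divisor graph of ℤ/pq

-- The predicate lives on ℕ rather than `Fin n`, so it can be shifted past an initial block. Both
-- `φ` and the sizes of the parts are brought to this form.
count : (ℕ → Bool) → ℕ → ℕ
count b n = ∣ tabulate {n = n} (b ∘ toℕ) ∣

count-cong : ∀ {b c} → b ≗ c → ∀ n → count b n ≡ count c n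
count-cong b≗c n = cong ∣_∣ (Vec.tabulate-cong {n = n} (b≗c ∘ toℕ))

count-+ : ∀ b m n → count b (m ℕ.+ n) ≡ count b m ℕ.+ count (b ∘ (m ℕ.+_)) n
count-+ b zero    n = refl
count-+ b (suc m) n with b 0
... | true  = cong suc (count-+ (b ∘ suc) m n)
... | false = count-+ (b ∘ suc) m n

count-true : ∀ b n → (∀ {k} → k < n → b k ≡ true) → count b n ≡ n
count-true b zero    _ = refl
count-true b (suc n) b≡true rewrite b≡true {0} (s≤s z≤n) =
  cong suc (count-true (b ∘ suc) n (b≡true ∘ s≤s))

count-false : ∀ b n → (∀ {k} → k < n → b k ≡ false) → count b n ≡ 0
count-false b zero    _ = refl
count-false b (suc n) b≡false rewrite b≡false {0} (s≤s z≤n) =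
  count-false (b ∘ suc) n (b≡false ∘ s≤s)

length-filter-applyUpTo : {P : Pred ℕ 0ℓ} (P? : Decidable P) (f : ℕ → ℕ) (n : ℕ) →
  length (filter P? (applyUpTo f n)) ≡ count (λ k → does (P? (f k))) n
length-filter-applyUpTo P? f zero    = refl
length-filter-applyUpTo P? f (suc n) with does (P? (f 0))
... | true  = cong suc (length-filter-applyUpTo P? (f ∘ suc) n)
... | false = length-filter-applyUpTo P? (f ∘ suc) n

-- Each block of `r` consecutive numbers, counted from 0, starts at a multiple of `r` and contains
-- no other.
count-∣ : ∀ r .{{_ : NonZero r}} m → count (λ k → does (r ∣? k)) (m ℕ.* r) ≡ m
count-∣ r           zero    = refl
count-∣ r@(suc r-1) (suc m) = begin
  count b (r ℕ.+ m ℕ.* r)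
    ≡⟨ count-+ b r (m ℕ.* r) ⟩
  -- `r ∣? 0` computes to true, so `count b r` unfolds to a successor.
  suc (count (b ∘ suc) r-1) ℕ.+ count (b ∘ (r ℕ.+_)) (m ℕ.* r)
    ≡⟨ cong₂ ℕ._+_
         (cong suc (count-false (b ∘ suc) r-1 λ k<r-1 → dec-false (r ∣? _) (>⇒∤ (s≤s k<r-1))))
         (trans (count-cong periodic (m ℕ.* r)) (count-∣ r m)) ⟩
  suc m ∎
  where
  open ≡-Reasoning
  b = λ k → does (r ∣? k)
  periodic : b ∘ (r ℕ.+_) ≗ b
  periodic k = does-⇔
    (mk⇔ (λ r∣r+k → ∣m+n∣m⇒∣n r∣r+k ∣-refl) (∣m∣n⇒∣m+n ∣-refl))
    (r ∣? (r ℕ.+ k)) (r ∣? k)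

-- Of 1, ..., p only p itself fails to be coprime to p. The successor avoids truncated subtraction
-- and matches `suc-∣multiples∣`.
suc-φ-prime : ∀ {p} → Prime p → suc (φ p) ≡ p
suc-φ-prime {zero}      p-prime = contradiction p-prime ¬prime[0]
suc-φ-prime {p@(suc m)} p-prime = cong suc $ begin
  φ p
    ≡⟨ cong (length ∘ filter (λ k → coprime? k p)) (map-upTo suc p) ⟩
  length (filter (λ k → coprime? k p) (applyUpTo suc p))
    ≡⟨ length-filter-applyUpTo (λ k → coprime? k p) suc p ⟩
  count b (suc m)
    -- The predicate is shifted by `suc`, so the last index `m` stands for p itself; it is split
    -- off.
    ≡⟨ cong (count b) (ℕ.+-comm 1 m) ⟩
  count b (m ℕ.+ 1)
    ≡⟨ count-+ b m 1 ⟩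
  count b m ℕ.+ count (b ∘ (m ℕ.+_)) 1
    ≡⟨ cong₂ ℕ._+_
         (count-true b m λ k<m →
           dec-true (coprime? _ p) (Coprime.sym (prime⇒coprime p-prime (s≤s k<m))))
         (count-false (b ∘ (m ℕ.+_)) 1 λ where
           (s≤s z≤n) → dec-false (coprime? _ p) λ cop → ¬prime[1]
             (subst Prime (cop (subst (p ∣_) (cong suc (sym (ℕ.+-identityʳ m))) ∣-refl , ∣-refl)) p-prime)) ⟩
  m ℕ.+ 0
    ≡⟨ ℕ.+-identityʳ m ⟩
  m ∎
  where
  open ≡-Reasoning
  b = λ k → does (coprime? (suc k) p)

-- Nonzero multiples and products modulo `n`

∈-tabulate⁺ : {P : Pred (Fin n) 0ℓ} (P? : Decidable P) → ∀ {u} → P u → u ∈ tabulate (does ∘ P?)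
∈-tabulate⁺ P? {u} Pu =
  Vec.lookup⇒[]= u _ (trans (Vec.lookup∘tabulate (does ∘ P?) u) (dec-true (P? u) Pu))

∈-tabulate⁻ : {P : Pred (Fin n) 0ℓ} (P? : Decidable P) → ∀ {u} → u ∈ tabulate (does ∘ P?) → P u
∈-tabulate⁻ P? {u} u∈
  with P? u | trans (sym (Vec.lookup∘tabulate (does ∘ P?) u)) (Vec.[]=⇒lookup u∈)
... | yes Pu | _ = Pu
... | no _   | ()

NonzeroMultiple : ℕ → Pred (Fin n) 0ℓ
NonzeroMultiple r u = toℕ u ≢ 0 × r ∣ toℕ u

nonzeroMultiple? : ∀ r → Decidable (NonzeroMultiple {n} r)
nonzeroMultiple? r u = ¬? (toℕ u ℕ.≟ 0) ×-dec (r ∣? toℕ u)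

multiples : ∀ n → ℕ → Subset n
multiples n r = tabulate (does ∘ nonzeroMultiple? r)

-- `count-∣` also counts 0, where `nonzeroMultiple?` is false; at successors the two tests agree by
-- computation. Exposing `m` and `r` as successors makes index 0 visible.
suc-∣multiples∣ : ∀ m r .{{_ : NonZero m}} .{{_ : NonZero r}} → suc ∣ multiples (m ℕ.* r) r ∣ ≡ m
suc-∣multiples∣ m@(suc _) r@(suc _) = count-∣ r m

module _ {n : ℕ} .{{_ : NonZero n}} where

  toℕ-0ₙ : toℕ (0ₙ {n}) ≡ 0
  toℕ-0ₙ = trans (toℕ-fromℕ< _) (m*n%n≡0 0 n)

  ≢0ₙ⇒toℕ≢0 : ∀ {u : Fin n} → u ≢ 0ₙ → toℕ u ≢ 0
  ≢0ₙ⇒toℕ≢0 u≢0 u≡0 = u≢0 (toℕ-injective (trans u≡0 (sym toℕ-0ₙ)))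

  toℕ≢0⇒≢0ₙ : ∀ {u : Fin n} → toℕ u ≢ 0 → u ≢ 0ₙ
  toℕ≢0⇒≢0ₙ u≢0 u≡0 = u≢0 (trans (cong toℕ u≡0) toℕ-0ₙ)

  *ₙ≡0ₙ⇒∣ : ∀ (u v : Fin n) → u *ₙ v ≡ 0ₙ → n ∣ toℕ u ℕ.* toℕ v
  *ₙ≡0ₙ⇒∣ u v uv≡0 = m%n≡0⇒n∣m _ n
    (trans (sym (toℕ-fromℕ< _)) (trans (cong toℕ uv≡0) toℕ-0ₙ))

  ∣⇒*ₙ≡0ₙ : ∀ (u v : Fin n) → n ∣ toℕ u ℕ.* toℕ v → u *ₙ v ≡ 0ₙ
  ∣⇒*ₙ≡0ₙ u v n∣uv = toℕ-injective
    (trans (toℕ-fromℕ< _) (trans (n∣m⇒m%n≡0 _ n n∣uv) (sym toℕ-0ₙ)))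

  nonzeroMultiple⇒n∤ : ∀ {r} {u : Fin n} → NonzeroMultiple r u → ¬ n ∣ toℕ u
  nonzeroMultiple⇒n∤ {u = u} (u≢0 , _) = >⇒∤ {{ℕ.≢-nonZero u≢0}} (toℕ<n u)

-- Write m as `k` times p: by coprimality q divides `k`, and multiplying by p gives the claim.
coprime-*-∣ : ∀ {p q m} → Coprime p q → p ∣ m → q ∣ m → p ℕ.* q ∣ m
coprime-*-∣ {p} {q} cop (divides-refl k) q∣kp = subst (_∣ k ℕ.* p) (ℕ.*-comm q p)
  (*-monoˡ-∣ p (coprime-divisor (Coprime.sym cop) (subst (q ∣_) (ℕ.*-comm k p) q∣kp)))

-- The bipartition into multiples of `q` and multiples of `p`

module _ {p q : ℕ} (p-prime : Prime p) (q-prime : Prime q) (cop : Coprime p q)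
         .{{_ : NonZero (p ℕ.* q)}} where

  private
    N = p ℕ.* q
    A = multiples N q
    B = multiples N p
    open Graph (Γ N)

    p<N : p < N
    p<N = ℕ.m<m*n p q {{prime⇒nonZero p-prime}} (nonTrivial⇒n>1 q {{prime⇒nonTrivial q-prime}})

    q<N : q < N
    q<N = subst (q <_) (ℕ.*-comm q p)
      (ℕ.m<m*n q p {{prime⇒nonZero q-prime}} (nonTrivial⇒n>1 p {{prime⇒nonTrivial p-prime}}))

    prime∈multiples : ∀ {r} → Prime r → r < N → Nonempty (multiples N r)
    prime∈multiples {r} r-prime r<N = fromℕ< r<N , ∈-tabulate⁺ (nonzeroMultiple? r)
      ( (λ r≡0 → ℕ.≢-nonZero⁻¹ r {{prime⇒nonZero r-prime}} (trans (sym (toℕ-fromℕ< r<N)) r≡0))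
      , subst (r ∣_) (sym (toℕ-fromℕ< r<N)) ∣-refl)

    ∈A⇒ : ∀ {u} → u ∈ A → NonzeroMultiple q u
    ∈A⇒ = ∈-tabulate⁻ (nonzeroMultiple? q)

    ∈B⇒ : ∀ {u} → u ∈ B → NonzeroMultiple p u
    ∈B⇒ = ∈-tabulate⁻ (nonzeroMultiple? p)

    -- Divisibility by both primes would make a nonzero residue below `N` a multiple of `N`.
    p∤A : ∀ {u} → u ∈ A → ¬ p ∣ toℕ u
    p∤A u∈A p∣u = nonzeroMultiple⇒n∤ (∈A⇒ u∈A) (coprime-*-∣ cop p∣u (proj₂ (∈A⇒ u∈A)))

    q∤B : ∀ {u} → u ∈ B → ¬ q ∣ toℕ u
    q∤B u∈B q∣u = nonzeroMultiple⇒n∤ (∈B⇒ u∈B) (coprime-*-∣ cop (proj₂ (∈B⇒ u∈B)) q∣u)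

    A*B≡0 : ∀ {u v} → u ∈ A → v ∈ B → u *ₙ v ≡ 0ₙ
    A*B≡0 {u} {v} u∈A v∈B = ∣⇒*ₙ≡0ₙ u v
      (subst (_∣ toℕ u ℕ.* toℕ v) (ℕ.*-comm q p) (*-pres-∣ (proj₂ (∈A⇒ u∈A)) (proj₂ (∈B⇒ v∈B))))

    vertex? : Decidable (λ (u : Fin N) → u ≢ 0ₙ × ZeroDivisor u)
    vertex? u = ¬? (u Fin.≟ 0ₙ) ×-dec zeroDivisor? u

    V⊆A∪B : V ⊆ A ∪ B
    V⊆A∪B {u} u∈V with ∈-tabulate⁻ vertex? u∈V
    ... | u≢0 , w , w≢0 , uw≡0 = x∈p∪q⁺ (part (q ∣? toℕ u))
      where
      N∣uw : N ∣ toℕ u ℕ.* toℕ w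
      N∣uw = *ₙ≡0ₙ⇒∣ u w uw≡0
      part : Dec (q ∣ toℕ u) → u ∈ A ⊎ u ∈ B
      part (yes q∣u) = inj₁ (∈-tabulate⁺ (nonzeroMultiple? q) (≢0ₙ⇒toℕ≢0 u≢0 , q∣u))
      -- Both primes divide the product of `u` and `w`. As `q` misses `u` it divides `w`, which puts
      -- `w` in `A`; so `p` misses `w` and divides `u`.
      part (no  q∤u) with euclidsLemma (toℕ u) (toℕ w) q-prime (∣-trans (n∣m*n p) N∣uw)
      ... | inj₁ q∣u = contradiction q∣u q∤u
      ... | inj₂ q∣w with euclidsLemma (toℕ u) (toℕ w) p-prime (∣-trans (m∣m*n q) N∣uw)
      ...   | inj₁ p∣u = inj₂ (∈-tabulate⁺ (nonzeroMultiple? p) (≢0ₙ⇒toℕ≢0 u≢0 , p∣u))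
      ...   | inj₂ p∣w = contradiction p∣w
        (p∤A (∈-tabulate⁺ (nonzeroMultiple? q) (≢0ₙ⇒toℕ≢0 w≢0 , q∣w)))

    A∪B⊆V : A ∪ B ⊆ V
    A∪B⊆V {u} u∈A∪B with x∈p∪q⁻ A B u∈A∪B
    -- The annihilator is the residue of the other prime: `p` lies in `B` and kills `A`, while `q`
    -- lies in `A` and kills `B`.
    ... | inj₁ u∈A = let w , w∈B = prime∈multiples p-prime p<N in
      ∈-tabulate⁺ vertex? ( toℕ≢0⇒≢0ₙ (proj₁ (∈A⇒ u∈A))
                          , w , toℕ≢0⇒≢0ₙ (proj₁ (∈B⇒ w∈B)) , A*B≡0 u∈A w∈B)
    ... | inj₂ u∈B = let w , w∈A = prime∈multiples q-prime q<N in
      ∈-tabulate⁺ vertex? ( toℕ≢0⇒≢0ₙ (proj₁ (∈B⇒ u∈B))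
                          , w , toℕ≢0⇒≢0ₙ (proj₁ (∈A⇒ w∈A)) , trans (*ₙ-comm u w) (A*B≡0 w∈A u∈B))

  Γ-completeBipartite : CompleteBipartite (Γ N) A B
  Γ-completeBipartite = record
    { partition    = ⊆-antisym V⊆A∪B A∪B⊆V
    ; disjoint     = λ u∈A u∈B → p∤A u∈A (proj₂ (∈B⇒ u∈B))
    -- Adjacency asks for distinct endpoints; equal ones would lie in both parts.
    ; adjacent     = λ u∈A v∈B → (λ { refl → p∤A u∈A (proj₂ (∈B⇒ v∈B)) }) , A*B≡0 u∈A v∈B
    -- If the product were zero, `p` would divide it and hence one of the factors, contrary to
    -- `p∤A`.
    ; independentˡ = λ {u} {v} u∈A v∈A (_ , uv≡0) →
        [ p∤A u∈A , p∤A v∈A ]′ (euclidsLemma _ _ p-prime (∣-trans (m∣m*n q) (*ₙ≡0ₙ⇒∣ u v uv≡0)))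
    ; independentʳ = λ {u} {v} u∈B v∈B (_ , uv≡0) →
        [ q∤B u∈B , q∤B v∈B ]′ (euclidsLemma _ _ q-prime (∣-trans (n∣m*n p) (*ₙ≡0ₙ⇒∣ u v uv≡0)))
    ; nonemptyˡ    = prime∈multiples q-prime q<N
    ; nonemptyʳ    = prime∈multiples p-prime p<N
    }

-- `n` is tied to the product by an equation, so that commutativity can swap the roles of the primes
-- while the modulus stays fixed.
∣multiples∣≡φ : ∀ {p q n} → Prime p → Prime q → n ≡ p ℕ.* q → ∣ multiples n q ∣ ≡ φ p
∣multiples∣≡φ {p} {q} p-prime q-prime refl = ℕ.suc-injective
  (trans (suc-∣multiples∣ p q {{prime⇒nonZero p-prime}} {{prime⇒nonZero q-prime}})
         (sym (suc-φ-prime p-prime)))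

theorem3p4 : (p q : ℕ) (p-prime : Prime p) (q-prime : Prime q) → 2 < q → q < p →
    let G = Γ (p ℕ.* q) {{prime*prime≢0 p-prime q-prime}} in
    (D G ≈ₚ ((1ₚ +ₚ X) ^ₚ φ p -ₚ 1ₚ) *ₚ ((1ₚ +ₚ X) ^ₚ φ q -ₚ 1ₚ) +ₚ X ^ₚ φ p +ₚ X ^ₚ φ q)
    × (Dₜ G ≈ₚ ((1ₚ +ₚ X) ^ₚ φ p -ₚ 1ₚ) *ₚ ((1ₚ +ₚ X) ^ₚ φ q -ₚ 1ₚ))
theorem3p4 p q p-prime q-prime _ q<p
  -- The exponents in the goal become sizes of parts: `φ p` counts the nonzero multiples of `q`, and
  -- `φ q` those of `p`.
  rewrite sym (∣multiples∣≡φ {p} {q} p-prime q-prime refl)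
        | sym (∣multiples∣≡φ {q} {p} q-prime p-prime (ℕ.*-comm p q))
  = D-completeBipartite K , Dₜ-completeBipartite K
  where
  instance
    _ = prime*prime≢0 p-prime q-prime
    _ = prime⇒nonZero q-prime
  -- A nonzero number below the prime `p` is coprime to it.
  K = Γ-completeBipartite p-prime q-prime (prime⇒coprime p-prime q<p)
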